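{- There exists a function $\gamma\colon\mathbb{N}\to\mathbb{N}$ such that for every $k\geq 2$, $n\geq 1$ and every $h\in\mathbb{N}$ with $h\leq\binom{n}{k}$, there exists a graph $G$ on $n+\gamma(k-1)-1$ vertices such that $\mathrm{sub}(K_k,G)=h$.
   Context: $K_k$ is the complete graph on $k$ vertices. For graphs $F,G$, $\mathrm{sub}(F,G)$ is the number of subgraphs $G'\subseteq G$ (i.e. $V(G')\subseteq V(G)$, $E(G')\subseteq E(G)$) with $G'\cong F$. -}

module Defs where

open import Data.Nat using (ℕ; zero; suc)
open import Data.Bool using (Bool; true; false; _∧_; if_then_else_)
open import Data.Fin using (Fin; _≟_)
open import Data.List using (List; []; _∷_; map; _++_; length; filter; allFin)
open import Data.Vec using (Vec; []; _∷_; lookup)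
open import Relation.Binary.PropositionalEquality using (_≡_)
open import Relation.Nullary using (¬_; does)

record Graph (m : ℕ) : Set where
  field
    adj  : Fin m → Fin m → Bool
    sym  : ∀ u v → adj u v ≡ adj v u
    irr  : ∀ v → adj v v ≡ false
open Graph public

VSet : ℕ → Set
VSet m = Vec Bool m

allVSets : (m : ℕ) → List (VSet m)
allVSets zero = [] ∷ []
allVSets (suc m) = map (false ∷_) (allVSets m) ++ map (true ∷_) (allVSets m)

card : ∀ {m} → VSet m → ℕ
card [] = 0
card (false ∷ s) = card s
card (true ∷ s) = suc (card s)

allB : {A : Set} → (A → Bool) → List A → Bool
allB p [] = true
allB p (x ∷ xs) = p x ∧ allB p xs

isCliqueB : ∀ {m} → Graph m → VSet m → Bool
isCliqueB {m} G S =
  allB (λ u → allB (λ v →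
        if lookup S u ∧ lookup S v
        then (if does (u ≟ v) then true else adj G u v)
        else true) (allFin m)) (allFin m)

-- k-vertex complete subgraphs: vertex set of size k that is a clique
-- (then the edge set is forced to be all pairs)
isKkB : ∀ {m} → ℕ → Graph m → VSet m → Bool
isKkB k G S = does (card S Data.Nat.≟ k) ∧ isCliqueB G S

-- sub(K_k, G): number of subgraphs G' ⊆ G with G' ≅ K_k.
subK : ∀ {m} → ℕ → Graph m → ℕ
subK k G = length (filter (λ S → Data.Bool._≟_ (isKkB k G S) true) (allVSets _))

{-# OPTIONS --safe #-}
module Submission where

-- Write k = d + 1.  Joining a new vertex to x vertices of a clique K_b creates C(x,d) new k-cliques.
-- Take K_b, L "hubs" joined to all of K_b and pairwise non-adjacent, further vertices joined to
-- x_i ≤ b vertices of K_b each, and one last vertex joined to d − 1 vertices of K_b and to r of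
-- the hubs.  The last vertex lies in exactly r cliques, so the total is
--   C(b,k) + L C(b,d) + Σ C(x_i,d) + r,   for any r ≤ L.
-- Suppose C(N,k) < h ≤ C(N+1,k) and b + L = N.  If d L² + d − 1 ≤ N, the first two terms leave a
-- remainder of at most 4 C(b,d).  Four vertices with x_i = b bring it down to at most C(b,d), and
-- then it is reduced greedily: replacing R by R − C(x,d) with x maximal, either the new remainder
-- is at most L, or it is at most R / M, where L = M^(3d) and M is about N^(1/(6d+2)).  As R is at
-- most a fixed power of M, boundedly many steps bring it down to at most L, and the last vertex
-- absorbs it.

open import Defs hiding (sym)
open import Data.Bool using (Bool; true; false; _∧_; if_then_else_)
import Data.Bool as Bool
open import Data.Bool.Properties
  using (∧-zeroʳ; ∧-identityʳ; ∧-assoc; ∧-comm; ∧-idem)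
import Data.Fin as Fin
open import Data.Fin using (Fin; zero; suc)
open import Data.List using (List; []; _∷_; _++_; map; length; filter; allFin; tabulate)
open import Data.Nat
open import Data.Nat.Combinatorics
open import Data.Nat.Properties hiding (_≟_; _≤?_)
open import Data.Nat.Tactic.RingSolver using (solve-∀)
open import Data.Product using (Σ; ∃; ∃₂; _×_; _,_)
open import Data.Sum using (_⊎_; inj₁; inj₂)
open import Data.Vec using ([]; _∷_; lookup; replicate; zipWith)
import Data.Vec as Vec
open import Data.Vec.Properties using (lookup-replicate)
open import Function using (_∘_)
open import Relation.Binary.PropositionalEquality
open import Relation.Nullary using (does; yes; no; contradiction)

private variable
  A B : Set
  m n : ℕ

-- Vertex sets and inclusion.

full : VSet m
full = replicate _ true

empty : VSet m
empty = replicate _ false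

_∩_ : VSet m → VSet m → VSet m
_∩_ = zipWith _∧_

_⊆ᵇ_ : VSet m → VSet m → Bool
[]          ⊆ᵇ []      = true
(false ∷ S) ⊆ᵇ (_ ∷ X) = S ⊆ᵇ X
(true ∷ S)  ⊆ᵇ (x ∷ X) = x ∧ (S ⊆ᵇ X)

⊆ᵇ-full : (S : VSet m) → S ⊆ᵇ full ≡ true
⊆ᵇ-full []          = refl
⊆ᵇ-full (false ∷ S) = ⊆ᵇ-full S
⊆ᵇ-full (true ∷ S)  = ⊆ᵇ-full S

⊆ᵇ-∩ : (S X Y : VSet m) → S ⊆ᵇ (X ∩ Y) ≡ (S ⊆ᵇ X) ∧ (S ⊆ᵇ Y)
⊆ᵇ-∩ []          []          []      = refl
⊆ᵇ-∩ (false ∷ S) (x ∷ X)     (y ∷ Y) = ⊆ᵇ-∩ S X Y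
⊆ᵇ-∩ (true ∷ S)  (false ∷ X) (y ∷ Y) = refl
⊆ᵇ-∩ (true ∷ S)  (true ∷ X)  (false ∷ Y) = sym (∧-zeroʳ (S ⊆ᵇ X))
⊆ᵇ-∩ (true ∷ S)  (true ∷ X)  (true ∷ Y) = ⊆ᵇ-∩ S X Y

∩-fullʳ : (X : VSet m) → X ∩ full ≡ X
∩-fullʳ []      = refl
∩-fullʳ (x ∷ X) = cong₂ _∷_ (∧-identityʳ x) (∩-fullʳ X)

∩-fullˡ : (X : VSet m) → full ∩ X ≡ X
∩-fullˡ []      = refl
∩-fullˡ (x ∷ X) = cong (x ∷_) (∩-fullˡ X)

-- The clique test after adding one vertex.

allB-cong : {p q : A → Bool} → (∀ x → p x ≡ q x) → ∀ xs → allB p xs ≡ allB q xs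
allB-cong e []       = refl
allB-cong e (x ∷ xs) = cong₂ _∧_ (e x) (allB-cong e xs)

allB-true : (xs : List A) → allB (λ _ → true) xs ≡ true
allB-true []       = refl
allB-true (x ∷ xs) = allB-true xs

allB-tabulate : (p : A → Bool) (f : Fin n → A) →
  allB p (tabulate f) ≡ allB (p ∘ f) (allFin n)
allB-tabulate {n = zero}  p f = refl
allB-tabulate {n = suc n} p f = cong (p (f zero) ∧_)
  (trans (allB-tabulate p (f ∘ suc)) (sym (allB-tabulate (p ∘ f) suc)))

allB-∧ : (p q : A → Bool) → ∀ xs → allB (λ x → p x ∧ q x) xs ≡ allB p xs ∧ allB q xs
allB-∧ p q []       = refl
allB-∧ p q (x ∷ xs) with p x | q x
... | false | _     = refl
... | true  | false = sym (∧-zeroʳ (allB p xs))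
... | true  | true  = allB-∧ p q xs

-- The row of a new vertex with neighbourhood X in the clique test reduces to this predicate.
inside : VSet m → VSet m → Fin m → Bool
inside S X u = if lookup S u then lookup X u else true

allB-inside : (S X : VSet m) → allB (inside S X) (allFin m) ≡ S ⊆ᵇ X
allB-inside []          []      = refl
allB-inside (false ∷ S) (x ∷ X) =
  trans (allB-tabulate (inside (false ∷ S) (x ∷ X)) suc) (allB-inside S X)
allB-inside (true ∷ S)  (x ∷ X) = cong (x ∧_)
  (trans (allB-tabulate (inside (true ∷ S) (x ∷ X)) suc) (allB-inside S X))

joined : Graph m → VSet m → Fin m → Fin m → Bool
joined G S u v =
  if lookup S u ∧ lookup S v then (if does (u Fin.≟ v) then true else adj G u v) else true

-- The new vertex is `zero`, so its membership in a vertex set is the head of the vector and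
-- counting follows the recursion of `allVSets`. All graphs below arise by iterating this operation.
extend : Graph m → VSet m → Graph (suc m)
extend {m} G X = record { adj = adj′ ; sym = sym′ ; irr = irr′ }
  where
  adj′ : Fin (suc m) → Fin (suc m) → Bool
  adj′ zero    zero    = false
  adj′ zero    (suc v) = lookup X v
  adj′ (suc u) zero    = lookup X u
  adj′ (suc u) (suc v) = adj G u v
  sym′ : ∀ u v → adj′ u v ≡ adj′ v u
  sym′ zero    zero    = refl
  sym′ zero    (suc v) = refl
  sym′ (suc u) zero    = refl
  sym′ (suc u) (suc v) = Graph.sym G u v
  irr′ : ∀ v → adj′ v v ≡ false
  irr′ zero    = refl
  irr′ (suc v) = irr G v

module _ (G : Graph m) (X S : VSet m) where

  private
    pairs : (s : Bool) (u : Fin m) → Bool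
    pairs s u = allB (joined (extend G X) (s ∷ S) (suc u)) (allFin (suc m))

    -- The first entry of the row of an old vertex compares it with the new one; the other entries
    -- are its old row.
    pairs-suc : ∀ s u → pairs s u ≡
      (if lookup S u ∧ s then lookup X u else true) ∧ allB (joined G S u) (allFin m)
    pairs-suc s u = cong ((if lookup S u ∧ s then lookup X u else true) ∧_)
      (allB-tabulate (joined (extend G X) (s ∷ S) (suc u)) suc)

    rows : ∀ s → allB (λ u → allB (joined (extend G X) (s ∷ S) u) (allFin (suc m))) (tabulate suc)
      ≡ allB (λ u → if lookup S u ∧ s then lookup X u else true) (allFin m) ∧ isCliqueB G S
    rows s = begin
      allB (λ u → allB (joined (extend G X) (s ∷ S) u) (allFin (suc m))) (tabulate suc)
        ≡⟨ allB-tabulate (λ u → allB (joined (extend G X) (s ∷ S) u) (allFin (suc m))) suc ⟩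
      allB (pairs s) (allFin m)
        ≡⟨ allB-cong (pairs-suc s) (allFin m) ⟩
      allB (λ u → (if lookup S u ∧ s then lookup X u else true)
        ∧ allB (joined G S u) (allFin m)) (allFin m)
        ≡⟨ allB-∧ (λ u → if lookup S u ∧ s then lookup X u else true)
            (λ u → allB (joined G S u) (allFin m)) (allFin m) ⟩
      allB (λ u → if lookup S u ∧ s then lookup X u else true) (allFin m) ∧ isCliqueB G S  ∎
      where open ≡-Reasoning

  isCliqueB-extend-false : isCliqueB (extend G X) (false ∷ S) ≡ isCliqueB G S
  isCliqueB-extend-false = cong₂ _∧_ (allB-true (allFin (suc m)))
    (trans (rows false) (cong (_∧ isCliqueB G S) (trans
      (allB-cong (λ u → cong (if_then lookup X u else true) (∧-zeroʳ (lookup S u))) (allFin m))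
      (allB-true (allFin m)))))

  -- The condition on X arises twice, from the row and from the column of the new vertex;
  -- idempotence of `_∧_` merges the two.
  isCliqueB-extend-true :
    isCliqueB (extend G X) (true ∷ S) ≡ isCliqueB G S ∧ (S ⊆ᵇ X)
  isCliqueB-extend-true = begin
    isCliqueB (extend G X) (true ∷ S)
      ≡⟨ cong₂ _∧_
          (trans (allB-tabulate (joined (extend G X) (true ∷ S) zero) suc) (allB-inside S X))
          (trans (rows true) (cong (_∧ isCliqueB G S) (trans
            (allB-cong (λ u → cong (if_then lookup X u else true) (∧-identityʳ (lookup S u)))
              (allFin m))
            (allB-inside S X)))) ⟩
    (S ⊆ᵇ X) ∧ ((S ⊆ᵇ X) ∧ isCliqueB G S)  ≡⟨ ∧-assoc (S ⊆ᵇ X) _ _ ⟨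
    ((S ⊆ᵇ X) ∧ (S ⊆ᵇ X)) ∧ isCliqueB G S  ≡⟨ cong (_∧ isCliqueB G S) (∧-idem (S ⊆ᵇ X)) ⟩
    (S ⊆ᵇ X) ∧ isCliqueB G S               ≡⟨ ∧-comm (S ⊆ᵇ X) _ ⟩
    isCliqueB G S ∧ (S ⊆ᵇ X)               ∎
    where open ≡-Reasoning

-- Counting cliques inside a vertex set.

count : (A → Bool) → List A → ℕ
count p xs = length (filter (λ x → p x Bool.≟ true) xs)

count-cong : {p q : A → Bool} → (∀ x → p x ≡ q x) → ∀ xs → count p xs ≡ count q xs
count-cong e [] = refl
count-cong {p = p} {q} e (x ∷ xs) with p x | q x | e x
... | false | _ | refl = count-cong e xs
... | true  | _ | refl = cong suc (count-cong e xs)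

count-false : (xs : List A) → count (λ _ → false) xs ≡ 0
count-false []       = refl
count-false (x ∷ xs) = count-false xs

count-++ : (p : A → Bool) → ∀ xs ys → count p (xs ++ ys) ≡ count p xs + count p ys
count-++ p []       ys = refl
count-++ p (x ∷ xs) ys with p x
... | false = count-++ p xs ys
... | true  = cong suc (count-++ p xs ys)

count-map : (p : B → Bool) (f : A → B) → ∀ xs → count p (map f xs) ≡ count (p ∘ f) xs
count-map p f []       = refl
count-map p f (x ∷ xs) with p (f x)
... | false = count-map p f xs
... | true  = cong suc (count-map p f xs)

-- Removing the new vertex from a clique leaves a smaller clique inside its neighbourhood, so the
-- recursion needs counts relative to a set Y.
cliquesIn : ℕ → Graph m → VSet m → ℕ
cliquesIn k G Y = count (λ S → isKkB k G S ∧ (S ⊆ᵇ Y)) (allVSets _)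

subK≡cliquesIn-full : (k : ℕ) (G : Graph m) → subK k G ≡ cliquesIn k G full
subK≡cliquesIn-full k G = count-cong
  (λ S → sym (trans (cong (isKkB k G S ∧_) (⊆ᵇ-full S)) (∧-identityʳ _))) (allVSets _)

module _ (G : Graph m) (X Y : VSet m) where

  private
    split : ∀ k y → cliquesIn k (extend G X) (y ∷ Y) ≡
      cliquesIn k G Y + count (λ S → isKkB k (extend G X) (true ∷ S) ∧ (y ∧ (S ⊆ᵇ Y))) (allVSets m)
    split k y = trans (count-++ _ (map (false ∷_) (allVSets m)) _) (cong₂ _+_
      (trans (count-map _ (false ∷_) (allVSets m)) (count-cong (λ S →
        cong (λ b → (does (card S ≟ k) ∧ b) ∧ (S ⊆ᵇ Y)) (isCliqueB-extend-false G X S))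
        (allVSets m)))
      (count-map _ (true ∷_) (allVSets m)))

  cliquesIn-extend-false : ∀ k → cliquesIn k (extend G X) (false ∷ Y) ≡ cliquesIn k G Y
  cliquesIn-extend-false k = trans (split k false) (trans
    (cong (cliquesIn k G Y +_)
      (trans (count-cong (λ S → ∧-zeroʳ _) (allVSets m)) (count-false (allVSets m))))
    (+-identityʳ _))

  cliquesIn-extend-true : ∀ k → cliquesIn (suc k) (extend G X) (true ∷ Y) ≡
    cliquesIn (suc k) G Y + cliquesIn k G (X ∩ Y)
  cliquesIn-extend-true k = trans (split (suc k) true)
    (cong (cliquesIn (suc k) G Y +_) (count-cong regroup (allVSets m)))
    where
    regroup : ∀ S → isKkB (suc k) (extend G X) (true ∷ S) ∧ (S ⊆ᵇ Y) ≡
      isKkB k G S ∧ (S ⊆ᵇ (X ∩ Y))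
    regroup S = begin
      (size ∧ isCliqueB (extend G X) (true ∷ S)) ∧ (S ⊆ᵇ Y)
        ≡⟨ cong (λ b → (size ∧ b) ∧ (S ⊆ᵇ Y)) (isCliqueB-extend-true G X S) ⟩
      (size ∧ (isCliqueB G S ∧ (S ⊆ᵇ X))) ∧ (S ⊆ᵇ Y)
        ≡⟨ cong (_∧ (S ⊆ᵇ Y)) (∧-assoc size _ _) ⟨
      (isKkB k G S ∧ (S ⊆ᵇ X)) ∧ (S ⊆ᵇ Y)  ≡⟨ ∧-assoc (isKkB k G S) _ _ ⟩
      isKkB k G S ∧ ((S ⊆ᵇ X) ∧ (S ⊆ᵇ Y))  ≡⟨ cong (isKkB k G S ∧_) (⊆ᵇ-∩ S X Y) ⟨
      isKkB k G S ∧ (S ⊆ᵇ (X ∩ Y))         ∎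
      where
      open ≡-Reasoning
      size : Bool
      size = does (card S ≟ k)

-- Only `empty` has cardinality 0, so only its value under p matters.
count-card≡0 : (p : VSet m → Bool) →
  count (λ S → does (card S ≟ 0) ∧ p S) (allVSets m) ≡ (if p empty then 1 else 0)
count-card≡0 {zero} p with p []
... | false = refl
... | true  = refl
count-card≡0 {suc m} p = begin
  count _ (map (false ∷_) (allVSets m) ++ map (true ∷_) (allVSets m))
    ≡⟨ count-++ _ (map (false ∷_) (allVSets m)) _ ⟩
  count _ (map (false ∷_) (allVSets m)) + count _ (map (true ∷_) (allVSets m))
    ≡⟨ cong₂ _+_ (count-map _ (false ∷_) (allVSets m)) (count-map _ (true ∷_) (allVSets m)) ⟩
  count (λ S → does (card S ≟ 0) ∧ p (false ∷ S)) (allVSets m)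
    + count (λ S → false) (allVSets m)
    ≡⟨ cong₂ _+_ (count-card≡0 (p ∘ (false ∷_))) (count-false (allVSets m)) ⟩
  (if p empty then 1 else 0) + 0
    ≡⟨ +-identityʳ _ ⟩
  (if p empty then 1 else 0)  ∎
  where open ≡-Reasoning

empty-⊆ᵇ : (Y : VSet m) → empty ⊆ᵇ Y ≡ true
empty-⊆ᵇ []      = refl
empty-⊆ᵇ (y ∷ Y) = empty-⊆ᵇ Y

isCliqueB-empty : (G : Graph m) → isCliqueB G empty ≡ true
isCliqueB-empty {m} G = trans (allB-cong (λ u → trans (allB-cong (λ v →
  cong (λ b → if b ∧ lookup empty v then (if does (u Fin.≟ v) then true else adj G u v) else true)
    (lookup-replicate u false))
  (allFin m)) (allB-true (allFin m))) (allFin m)) (allB-true (allFin m))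

cliquesIn-0 : (G : Graph m) (Y : VSet m) → cliquesIn 0 G Y ≡ 1
cliquesIn-0 {m} G Y = begin
  cliquesIn 0 G Y
    ≡⟨ count-cong (λ S → ∧-assoc (does (card S ≟ 0)) _ _) (allVSets m) ⟩
  count (λ S → does (card S ≟ 0) ∧ (isCliqueB G S ∧ (S ⊆ᵇ Y))) (allVSets m)
    ≡⟨ count-card≡0 (λ S → isCliqueB G S ∧ (S ⊆ᵇ Y)) ⟩
  (if isCliqueB G empty ∧ (empty ⊆ᵇ Y) then 1 else 0)
    ≡⟨ cong (if_then 1 else 0) (cong₂ _∧_ (isCliqueB-empty G) (empty-⊆ᵇ Y)) ⟩
  1  ∎
  where open ≡-Reasoning

nC0≡1 : ∀ n → n C 0 ≡ 1
nC0≡1 n = trans (nCk≡nC[n∸k] {0} {n} z≤n) (nCn≡1 n)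

-- The graphs of the construction and their clique counts.

firstN : ℕ → VSet m
firstN {zero}  x       = []
firstN {suc m} zero    = false ∷ firstN zero
firstN {suc m} (suc x) = true ∷ firstN x

card-firstN : ∀ {x b} → x ≤ b → card (firstN {b} x) ≡ x
card-firstN {b = zero}  z≤n       = refl
card-firstN {b = suc b} z≤n       = card-firstN {b = b} z≤n
card-firstN {b = suc b} (s≤s x≤b) = cong suc (card-firstN x≤b)

complete : ∀ b → Graph b
complete zero    = record { adj = λ () ; sym = λ () ; irr = λ () }
complete (suc b) = extend (complete b) full

cliquesIn-complete : ∀ k b (Y : VSet b) → cliquesIn k (complete b) Y ≡ card Y C k
cliquesIn-complete zero    b Y  = trans (cliquesIn-0 (complete b) Y) (sym (nC0≡1 (card Y)))
cliquesIn-complete (suc k) zero [] = refl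
cliquesIn-complete (suc k) (suc b) (false ∷ Y) =
  trans (cliquesIn-extend-false (complete b) full Y (suc k)) (cliquesIn-complete (suc k) b Y)
cliquesIn-complete (suc k) (suc b) (true ∷ Y) = begin
  cliquesIn (suc k) (complete (suc b)) (true ∷ Y)
    ≡⟨ cliquesIn-extend-true (complete b) full Y k ⟩
  cliquesIn (suc k) (complete b) Y + cliquesIn k (complete b) (full ∩ Y)
    ≡⟨ cong (λ Z → cliquesIn (suc k) (complete b) Y + cliquesIn k (complete b) Z) (∩-fullˡ Y) ⟩
  cliquesIn (suc k) (complete b) Y + cliquesIn k (complete b) Y
    ≡⟨ cong₂ _+_ (cliquesIn-complete (suc k) b Y) (cliquesIn-complete k b Y) ⟩
  card Y C suc k + card Y C k  ≡⟨ +-comm (card Y C suc k) _ ⟩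
  card Y C k + card Y C suc k  ≡⟨ nCk+nC[k+1]≡[n+1]C[k+1] (card Y) k ⟩
  suc (card Y) C suc k         ∎
  where open ≡-Reasoning

full-++ : ∀ m {n} → full {m} Vec.++ full {n} ≡ full
full-++ zero    = refl
full-++ (suc m) = cong (true ∷_) (full-++ m)

empty-++-∩ : (Z : VSet m) (X Y : VSet n) →
  (empty {m} Vec.++ X) ∩ (Z Vec.++ Y) ≡ empty {m} Vec.++ (X ∩ Y)
empty-++-∩ []      X Y = refl
empty-++-∩ (z ∷ Z) X Y = cong (false ∷_) (empty-++-∩ Z X Y)

-- The block `empty {r}` keeps the hubs pairwise non-adjacent; the core occupies the last b
-- positions.
hubs : ∀ b r → Graph (r + b)
hubs b zero    = complete b
hubs b (suc r) = extend (hubs b r) (empty {r} Vec.++ full {b})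

cliquesIn-hubs-empty : ∀ k b r (Y : VSet b) →
  cliquesIn k (hubs b r) (empty {r} Vec.++ Y) ≡ card Y C k
cliquesIn-hubs-empty k b zero    Y = cliquesIn-complete k b Y
cliquesIn-hubs-empty k b (suc r) Y =
  trans (cliquesIn-extend-false (hubs b r) _ _ k) (cliquesIn-hubs-empty k b r Y)

-- A clique contains at most one hub, and each hub completes every k-subset of Y. If Y has exactly k
-- vertices, the first summand vanishes and r remains: this is how the last vertex contributes an
-- arbitrary small number.
cliquesIn-hubs-full : ∀ k b r (Y : VSet b) →
  cliquesIn (suc k) (hubs b r) (full {r} Vec.++ Y) ≡ card Y C suc k + r * (card Y C k)
cliquesIn-hubs-full k b zero    Y = trans (cliquesIn-complete (suc k) b Y) (sym (+-identityʳ _))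
cliquesIn-hubs-full k b (suc r) Y = begin
  cliquesIn (suc k) (hubs b (suc r)) (true ∷ full {r} Vec.++ Y)
    ≡⟨ cliquesIn-extend-true (hubs b r) _ _ k ⟩
  cliquesIn (suc k) (hubs b r) (full {r} Vec.++ Y)
    + cliquesIn k (hubs b r) ((empty {r} Vec.++ full {b}) ∩ (full {r} Vec.++ Y))
    ≡⟨ cong₂ _+_ (cliquesIn-hubs-full k b r Y) (trans
        (cong (cliquesIn k (hubs b r)) (trans (empty-++-∩ (full {r}) full Y)
          (cong (empty {r} Vec.++_) (∩-fullˡ Y))))
        (cliquesIn-hubs-empty k b r Y)) ⟩
  card Y C suc k + r * (card Y C k) + card Y C k
    ≡⟨ +-assoc (card Y C suc k) _ _ ⟩
  card Y C suc k + (r * (card Y C k) + card Y C k)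
    ≡⟨ cong (card Y C suc k +_) (+-comm _ (card Y C k)) ⟩
  card Y C suc k + suc r * (card Y C k)  ∎
  where open ≡-Reasoning

infixr 5 _∷_
-- A derivation is a recipe for a graph: each term stands for one further vertex joined to x of the
-- b core vertices.
data BinomialSum (b d : ℕ) : ℕ → ℕ → Set where
  []  : BinomialSum b d 0 0
  _∷_ : ∀ {x t R} → x ≤ b → BinomialSum b d t R → BinomialSum b d (suc t) (x C d + R)

module _ {b d : ℕ} (r : ℕ) where

  sprouts : ∀ {t R} → BinomialSum b d t R → Graph (t + (r + b))
  sprouts []              = hubs b r
  sprouts (_∷_ {x} {t} _ s) =
    extend (sprouts s) (empty {t} Vec.++ (empty {r} Vec.++ firstN {b} x))

  cliquesIn-sprouts-empty : ∀ {t R} (s : BinomialSum b d t R) k (Y : VSet (r + b)) →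
    cliquesIn k (sprouts s) (empty {t} Vec.++ Y) ≡ cliquesIn k (hubs b r) Y
  cliquesIn-sprouts-empty []      k Y = refl
  cliquesIn-sprouts-empty (_ ∷ s) k Y =
    trans (cliquesIn-extend-false (sprouts s) _ _ k) (cliquesIn-sprouts-empty s k Y)

  cliquesIn-sprouts-full : ∀ {t R} (s : BinomialSum b d t R) →
    cliquesIn (suc d) (sprouts s) (full {t} Vec.++ full {r + b})
      ≡ R + cliquesIn (suc d) (hubs b r) full
  cliquesIn-sprouts-full [] = refl
  cliquesIn-sprouts-full (_∷_ {x} {t} {R} x≤b s) = begin
    cliquesIn (suc d) (extend (sprouts s) X) (true ∷ full {t} Vec.++ full)
      ≡⟨ cliquesIn-extend-true (sprouts s) X _ d ⟩
    cliquesIn (suc d) (sprouts s) (full {t} Vec.++ full)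
      + cliquesIn d (sprouts s) (X ∩ (full {t} Vec.++ full))
      ≡⟨ cong₂ _+_ (cliquesIn-sprouts-full s) neighbourhood ⟩
    R + H + x C d    ≡⟨ +-comm (R + H) (x C d) ⟩
    x C d + (R + H)  ≡⟨ +-assoc (x C d) R H ⟨
    x C d + R + H    ∎
    where
    open ≡-Reasoning
    X : VSet (t + (r + b))
    X = empty {t} Vec.++ (empty {r} Vec.++ firstN {b} x)
    H : ℕ
    H = cliquesIn (suc d) (hubs b r) full
    neighbourhood : cliquesIn d (sprouts s) (X ∩ (full {t} Vec.++ full)) ≡ x C d
    neighbourhood = begin
      cliquesIn d (sprouts s) (X ∩ (full {t} Vec.++ full))
        ≡⟨ cong (cliquesIn d (sprouts s)) (trans (cong (X ∩_) (full-++ t)) (∩-fullʳ X)) ⟩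
      cliquesIn d (sprouts s) X
        ≡⟨ cliquesIn-sprouts-empty s d _ ⟩
      cliquesIn d (hubs b r) (empty {r} Vec.++ firstN {b} x)
        ≡⟨ cliquesIn-hubs-empty d b r _ ⟩
      card (firstN {b} x) C d
        ≡⟨ cong (_C d) (card-firstN x≤b) ⟩
      x C d  ∎

card-full : ∀ b → card (full {b}) ≡ b
card-full zero    = refl
card-full (suc b) = cong suc (card-full b)

-- The last vertex sees e core vertices and the r hubs, hence lies in exactly r cliques of size e + 2.
realise : ∀ {b e t R} r → e ≤ b → BinomialSum b (suc e) t R →
  Σ (Graph (suc (t + (r + b)))) λ G →
    subK (suc (suc e)) G ≡ b C suc (suc e) + r * (b C suc e) + R + r
realise {b} {e} {t} {R} r e≤b s = extend (sprouts r s) X , (begin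
  subK (suc (suc e)) (extend (sprouts r s) X)
    ≡⟨ subK≡cliquesIn-full (suc (suc e)) (extend (sprouts r s) X) ⟩
  cliquesIn (suc (suc e)) (extend (sprouts r s) X) full
    ≡⟨ cliquesIn-extend-true (sprouts r s) X full (suc e) ⟩
  cliquesIn (suc (suc e)) (sprouts r s) full + cliquesIn (suc e) (sprouts r s) (X ∩ full)
    ≡⟨ cong₂ _+_ old new ⟩
  b C suc (suc e) + r * (b C suc e) + R + r  ∎)
  where
  open ≡-Reasoning
  X : VSet (t + (r + b))
  X = empty {t} Vec.++ (full {r} Vec.++ firstN {b} e)
  old : cliquesIn (suc (suc e)) (sprouts r s) full ≡ b C suc (suc e) + r * (b C suc e) + R
  old = begin
    cliquesIn (suc (suc e)) (sprouts r s) full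
      ≡⟨ cong (cliquesIn (suc (suc e)) (sprouts r s)) (full-++ t) ⟨
    cliquesIn (suc (suc e)) (sprouts r s) (full {t} Vec.++ full)
      ≡⟨ cliquesIn-sprouts-full r s ⟩
    R + cliquesIn (suc (suc e)) (hubs b r) full
      ≡⟨ cong (λ Y → R + cliquesIn (suc (suc e)) (hubs b r) Y) (full-++ r) ⟨
    R + cliquesIn (suc (suc e)) (hubs b r) (full {r} Vec.++ full {b})
      ≡⟨ cong (R +_) (cliquesIn-hubs-full (suc e) b r full) ⟩
    R + (card (full {b}) C suc (suc e) + r * (card (full {b}) C suc e))
      ≡⟨ cong (λ c → R + (c C suc (suc e) + r * (c C suc e))) (card-full b) ⟩
    R + (b C suc (suc e) + r * (b C suc e))
      ≡⟨ +-comm R _ ⟩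
    b C suc (suc e) + r * (b C suc e) + R  ∎
  new : cliquesIn (suc e) (sprouts r s) (X ∩ full) ≡ r
  new = begin
    cliquesIn (suc e) (sprouts r s) (X ∩ full)
      ≡⟨ cong (cliquesIn (suc e) (sprouts r s)) (∩-fullʳ X) ⟩
    cliquesIn (suc e) (sprouts r s) X
      ≡⟨ cliquesIn-sprouts-empty r s (suc e) _ ⟩
    cliquesIn (suc e) (hubs b r) (full {r} Vec.++ firstN {b} e)
      ≡⟨ cliquesIn-hubs-full e b r _ ⟩
    card (firstN {b} e) C suc e + r * (card (firstN {b} e) C e)
      ≡⟨ cong (λ c → c C suc e + r * (c C e)) (card-firstN e≤b) ⟩
    e C suc e + r * (e C e)
      ≡⟨ cong₂ (λ p q → p + r * q) (k>n⇒nCk≡0 (n<1+n e)) (nCn≡1 e) ⟩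
    r * 1
      ≡⟨ *-identityʳ r ⟩
    r  ∎

-- Estimates for binomial coefficients.

C-monoˡ-suc : ∀ n k → n C k ≤ suc n C k
C-monoˡ-suc n zero    = ≤-reflexive (trans (nC0≡1 n) (sym (nC0≡1 (suc n))))
C-monoˡ-suc n (suc k) = subst (n C suc k ≤_) (nCk+nC[k+1]≡[n+1]C[k+1] n k) (m≤n+m _ _)

C-monoˡ : ∀ {m n} k → m ≤ n → m C k ≤ n C k
C-monoˡ k m≤n = go (≤⇒≤′ m≤n)
  where
  go : ∀ {m n} → m ≤′ n → m C k ≤ n C k
  go ≤′-refl        = ≤-refl
  go (≤′-step m≤′n) = ≤-trans (go m≤′n) (C-monoˡ-suc _ k)

C≤^ : ∀ n k → n C k ≤ n ^ k
C≤^ n       zero    = ≤-reflexive (nC0≡1 n)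
C≤^ zero    (suc k) = z≤n
C≤^ (suc n) (suc k) = begin
  suc n C suc k            ≡⟨ nCk+nC[k+1]≡[n+1]C[k+1] n k ⟨
  n C k + n C suc k        ≤⟨ +-mono-≤ (C≤^ n k) (C≤^ n (suc k)) ⟩
  suc n * n ^ k            ≤⟨ *-monoʳ-≤ (suc n) (^-monoˡ-≤ k (n≤1+n n)) ⟩
  suc n ^ suc k            ∎
  where open ≤-Reasoning

k≤n⇒nCk>0 : ∀ {n k} → k ≤ n → 1 ≤ n C k
k≤n⇒nCk>0 {n} {k} k≤n = subst (_≤ n C k) (nCn≡1 k) (C-monoˡ k k≤n)

-- Writing the upper index as `m + k` avoids truncated subtraction. After Pascal's rule both
-- inductive calls concern the same upper index N.
absorption : ∀ k m → suc k * ((m + k) C suc k) ≡ m * ((m + k) C k)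
absorption k zero = trans (cong (suc k *_) (k>n⇒nCk≡0 (n<1+n k))) (*-zeroʳ (suc k))
absorption zero (suc m) = begin
  1 * ((suc m + 0) C 1)        ≡⟨ *-identityˡ _ ⟩
  (suc m + 0) C 1              ≡⟨ nC1≡n (suc m + 0) ⟩
  suc m + 0                    ≡⟨ +-identityʳ (suc m) ⟩
  suc m                        ≡⟨ *-identityʳ (suc m) ⟨
  suc m * 1                    ≡⟨ cong (suc m *_) (nC0≡1 (suc m + 0)) ⟨
  suc m * ((suc m + 0) C 0)    ∎
  where open ≡-Reasoning
absorption (suc k) (suc m) = begin
  suc (suc k) * (suc N C suc (suc k))
    ≡⟨ cong (suc (suc k) *_) (nCk+nC[k+1]≡[n+1]C[k+1] N (suc k)) ⟨
  suc (suc k) * (N C suc k + N C suc (suc k))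
    ≡⟨ *-distribˡ-+ (suc (suc k)) (N C suc k) _ ⟩
  suc (suc k) * (N C suc k) + suc (suc k) * (N C suc (suc k))
    ≡⟨ cong (suc (suc k) * (N C suc k) +_) (absorption (suc k) m) ⟩
  suc (suc k) * (N C suc k) + m * (N C suc k)
    ≡⟨ alg k m (N C suc k) ⟩
  suc k * (N C suc k) + suc m * (N C suc k)
    ≡⟨ cong (_+ suc m * (N C suc k))
         (subst (λ z → suc k * (z C suc k) ≡ suc m * (z C k)) (sym (+-suc m k)) (absorption k (suc m))) ⟩
  suc m * (N C k) + suc m * (N C suc k)
    ≡⟨ *-distribˡ-+ (suc m) (N C k) _ ⟨
  suc m * (N C k + N C suc k)
    ≡⟨ cong (suc m *_) (nCk+nC[k+1]≡[n+1]C[k+1] N k) ⟩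
  suc m * (suc N C suc k)  ∎
  where
  open ≡-Reasoning
  N : ℕ
  N = m + suc k
  alg : ∀ k m c → suc (suc k) * c + m * c ≡ suc k * c + suc m * c
  alg = solve-∀

-- By `absorption` the ratio of the two binomials is (n - k) / (k + 1), which the hypothesis makes
-- at least c.
*-C≤C-suc : ∀ c {n k} → suc k * c + k ≤ n → c * (n C k) ≤ n C suc k
*-C≤C-suc c {n} {k} bound = *-cancelˡ-≤ (suc k) (begin
  suc k * (c * (n C k))          ≡⟨ *-assoc (suc k) c _ ⟨
  suc k * c * (n C k)            ≤⟨ *-monoˡ-≤ (n C k) (m+n≤o⇒m≤o∸n (suc k * c) bound) ⟩
  (n ∸ k) * (n C k)              ≡⟨ subst (λ z → suc k * (z C suc k) ≡ (n ∸ k) * (z C k))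
                                      (m∸n+n≡m (m+n≤o⇒n≤o (suc k * c) bound)) (absorption k (n ∸ k)) ⟨
  suc k * (n C suc k)            ∎)
  where open ≤-Reasoning

-- Pascal's rule applied L times: each increment is at least `b C k`. The next lemma bounds each
-- increment by `(L + b) C k`.
C-suc-+-lower : ∀ b L k → b C suc k + L * (b C k) ≤ (L + b) C suc k
C-suc-+-lower b zero    k = ≤-reflexive (+-identityʳ _)
C-suc-+-lower b (suc L) k = begin
  b C suc k + (b C k + L * (b C k))    ≡⟨ alg (b C suc k) (b C k) (L * (b C k)) ⟩
  b C k + (b C suc k + L * (b C k))    ≤⟨ +-mono-≤ (C-monoˡ k (m≤n+m b L)) (C-suc-+-lower b L k) ⟩
  (L + b) C k + (L + b) C suc k        ≡⟨ nCk+nC[k+1]≡[n+1]C[k+1] (L + b) k ⟩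
  suc (L + b) C suc k                  ∎
  where
  open ≤-Reasoning
  alg : ∀ x y z → x + (y + z) ≡ y + (x + z)
  alg = solve-∀

C-suc-+-upper : ∀ b L k → (L + b) C suc k ≤ b C suc k + L * ((L + b) C k)
C-suc-+-upper b zero    k = ≤-reflexive (sym (+-identityʳ _))
C-suc-+-upper b (suc L) k = begin
  suc (L + b) C suc k                          ≡⟨ nCk+nC[k+1]≡[n+1]C[k+1] (L + b) k ⟨
  (L + b) C k + (L + b) C suc k                ≤⟨ +-monoʳ-≤ ((L + b) C k) (C-suc-+-upper b L k) ⟩
  (L + b) C k + (b C suc k + L * ((L + b) C k)) ≡⟨ alg ((L + b) C k) (b C suc k) L ⟩
  b C suc k + suc L * ((L + b) C k)
    ≤⟨ +-monoʳ-≤ (b C suc k) (*-monoʳ-≤ (suc L) (C-monoˡ-suc (L + b) k)) ⟩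
  b C suc k + suc L * (suc (L + b) C k)        ∎
  where
  open ≤-Reasoning
  alg : ∀ x y L → x + (y + L * x) ≡ y + suc L * x
  alg = solve-∀

-- Sums of binomial coefficients and the greedy reduction.

-- A discrete intermediate value principle, searching downwards from n. It supplies both the x of a
-- greedy step and the integer root M.
crossing : (f : ℕ → ℕ) {R : ℕ} → f 0 ≤ R → ∀ n → R < f n →
  ∃ λ x → x < n × f x ≤ R × R < f (suc x)
crossing f f0≤R zero    R<f0 = contradiction f0≤R (<⇒≱ R<f0)
crossing f {R} f0≤R (suc n) R<fn with f n ≤? R
... | yes fn≤R = n , ≤-refl , fn≤R , R<fn
... | no  fn≰R with crossing f f0≤R n (≰⇒> fn≰R)
...   | x , x<n , low , high = x , m<n⇒m<1+n x<n , low , high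

-- Isolated vertices contribute `0 C suc e`, which is 0, and bring the number of terms to a
-- prescribed value.
pad : ∀ {b e t R} j → BinomialSum b (suc e) t R → BinomialSum b (suc e) (j + t) R
pad zero    s = s
pad (suc j) s = z≤n ∷ pad j s

infixr 5 _++ˢ_
_++ˢ_ : ∀ {b d t t′ R R′} → BinomialSum b d t R → BinomialSum b d t′ R′ →
  BinomialSum b d (t + t′) (R + R′)
[]      ++ˢ s′ = s′
_++ˢ_ {b} {d} {R′ = R′} (_∷_ {x} {t} {R} x≤b s) s′ =
  subst (BinomialSum b d _) (sym (+-assoc (x C d) R R′)) (x≤b ∷ (s ++ˢ s′))

copies : ∀ {b d} c {x} → x ≤ b → BinomialSum b d c (c * (x C d))
copies zero    x≤b = []
copies (suc c) x≤b = x≤b ∷ copies c x≤b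

divideOut : ∀ {b e} q {R} → R ≤ q * (b C suc e) →
  ∃₂ λ T R′ → BinomialSum b (suc e) q T × R ≡ T + R′ × R′ ≤ b C suc e
divideOut zero R≤0 = 0 , 0 , [] , n≤0⇒n≡0 R≤0 , z≤n
divideOut {b} {e} (suc q) {R} R≤ with R ≤? b C suc e
... | yes small = 0 , R ,
  subst (λ z → BinomialSum b (suc e) z 0) (+-identityʳ (suc q)) (pad (suc q) []) , refl , small
... | no large with divideOut {b} {e} q (m≤n+o⇒m∸n≤o R (b C suc e) R≤)
...   | T , R′ , s , eq , R′≤ = b C suc e + T , R′ , ≤-refl ∷ s , (begin
  R                                    ≡⟨ m+[n∸m]≡n (<⇒≤ (≰⇒> large)) ⟨
  b C suc e + (R ∸ b C suc e)          ≡⟨ cong (b C suc e +_) eq ⟩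
  b C suc e + (T + R′)                 ≡⟨ +-assoc (b C suc e) T R′ ⟨
  b C suc e + T + R′                   ∎) , R′≤
  where open ≡-Reasoning

-- L is what the last vertex can absorb; `small` covers those x for which `*-C≤C-suc` does not
-- supply the factor M.
module Greedy (b e M L : ℕ)
  (small : ∀ x → x < suc e * M + e → x C e ≤ L) where

  private d = suc e

  -- As R < C(x + 1, d), Pascal's rule bounds the remainder by C(x, e). For small x this is at most
  -- L; otherwise it is at most C(x, d) / M, hence at most R / M.
  step : ∀ {R} → R < suc b C d → ∃₂ λ x R′ →
    x ≤ b × R ≡ x C d + R′ × (R′ ≤ L ⊎ R′ * M ≤ R)
  step {R} R< with crossing (_C d) z≤n (suc b) R<
  ... | x , s≤s x≤b , low , high = x , R′ , x≤b , sym (m+[n∸m]≡n low) , shrink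
    where
    open ≤-Reasoning
    R′ = R ∸ x C d
    R′≤ : R′ ≤ x C e
    R′≤ = m≤n+o⇒m∸n≤o R (x C d) (begin
      R                  ≤⟨ <⇒≤ high ⟩
      suc x C d          ≡⟨ nCk+nC[k+1]≡[n+1]C[k+1] x e ⟨
      x C e + x C d      ≡⟨ +-comm (x C e) _ ⟩
      x C d + x C e      ∎)
    shrink : R′ ≤ L ⊎ R′ * M ≤ R
    shrink with d * M + e ≤? x
    ... | no  x≱ = inj₁ (≤-trans R′≤ (small x (≰⇒> x≱)))
    ... | yes x≥ = inj₂ (begin
      R′ * M       ≤⟨ *-monoˡ-≤ M R′≤ ⟩
      (x C e) * M  ≡⟨ *-comm (x C e) M ⟩
      M * (x C e)  ≤⟨ *-C≤C-suc M x≥ ⟩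
      x C d        ≤⟨ low ⟩
      R            ∎)

  greedy : ∀ t {R} → R < suc b C d → R ≤ L ⊎ R < M ^ t →
    ∃₂ λ T r → BinomialSum b d t T × R ≡ T + r × r ≤ L
  greedy zero {R} R< (inj₁ R≤L)       = 0 , R , [] , refl , R≤L
  -- With no rounds left, `R < M ^ 0` forces R to be 0.
  greedy zero {R} R< (inj₂ (s≤s z≤n)) = 0 , 0 , [] , refl , z≤n
  greedy (suc t) {R} R< bound with step R<
  ... | x , R′ , x≤b , refl , shrink with greedy t (≤-<-trans R′≤R R<) (next bound shrink)
    where
    R′≤R : R′ ≤ R
    R′≤R = m≤n+m R′ (x C d)
    next : R ≤ L ⊎ R < M ^ suc t → R′ ≤ L ⊎ R′ * M ≤ R → R′ ≤ L ⊎ R′ < M ^ t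
    next _          (inj₁ R′≤L) = inj₁ R′≤L
    next (inj₁ R≤L) (inj₂ _)    = inj₁ (≤-trans R′≤R R≤L)
    next (inj₂ R<M) (inj₂ R′M≤) = inj₂ (*-cancelʳ-< M R′ (M ^ t)
      (subst (R′ * M <_) (*-comm M (M ^ t)) (≤-<-trans R′M≤ R<M)))
  ...   | T , r , s , refl , r≤L = x C d + T , r , x≤b ∷ s , sym (+-assoc (x C d) T r) , r≤L

-- Representable clique counts.

-- Here r counts only the hubs adjacent to the last vertex; the other hubs are among the terms with
-- x = b.
record Representable (e N h : ℕ) : Set where
  constructor representation
  field
    {b t r R} : ℕ
    e≤b      : e ≤ b
    terms    : BinomialSum b (suc e) t R
    size     : suc (t + (r + b)) ≤ N
    total    : h ≡ b C suc (suc e) + r * (b C suc e) + R + r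

Representable-mono : ∀ {e N N′ h} → N ≤ N′ → Representable e N h → Representable e N′ h
Representable-mono N≤N′ (representation e≤b s size total) =
  representation e≤b s (≤-trans size N≤N′) total

representable⇒graph : ∀ {e N h} → Representable e N h →
  Σ (Graph N) λ G → subK (suc (suc e)) G ≡ h
representable⇒graph {e} {N} {h} (representation {b} {t} {r} {R} e≤b s size total) =
  subst (λ n → Σ (Graph n) λ G → subK (suc (suc e)) G ≡ h) vertices (G , trans count≡ (sym total))
  where
  j : ℕ
  j = N ∸ suc (t + (r + b))
  vertices : suc (j + t + (r + b)) ≡ N
  vertices = begin
    suc (j + t + (r + b))      ≡⟨ cong suc (+-assoc j t (r + b)) ⟩
    suc (j + (t + (r + b)))    ≡⟨ +-suc j _ ⟨
    j + suc (t + (r + b))      ≡⟨ m∸n+n≡m size ⟩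
    N                          ∎
    where open ≡-Reasoning
  open Σ (realise r e≤b (pad j s)) renaming (proj₁ to G; proj₂ to count≡)

-- The core is a clique on d = e + 1 vertices, and each of h vertices joined to all of it creates
-- one clique. The cost in vertices grows with h, so this serves bounded n only.
representable-few : ∀ e h → Representable e (suc (h + suc e)) h
representable-few e h = representation {b = suc e} {r = 0} (n≤1+n e) (copies h ≤-refl) ≤-refl (begin
  h                                              ≡⟨ *-identityʳ h ⟨
  h * 1                                          ≡⟨ cong (h *_) (nCn≡1 (suc e)) ⟨
  h * (suc e C suc e)
    ≡⟨ cong (λ z → z + 0 + h * (suc e C suc e)) (k>n⇒nCk≡0 (n<1+n (suc e))) ⟨
  suc e C suc (suc e) + 0 + h * (suc e C suc e)  ≡⟨ +-identityʳ _ ⟨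
  suc e C suc (suc e) + 0 + h * (suc e C suc e) + 0  ∎)
  where open ≡-Reasoning

-- The contribution of the core and the hubs.

module Core {e L N : ℕ} (2≤L : 2 ≤ L) (large : suc e * (L * L) + e ≤ N) where

  private
    b = N ∸ L
    d = suc e
    c = b C d

    L+e≤N : L + e ≤ N
    L+e≤N = ≤-trans (+-monoˡ-≤ e (≤-trans (m≤m*n L L {{>-nonZero (≤-trans (s≤s z≤n) 2≤L)}})
      (m≤n*m (L * L) d))) large

  L+b≡N : L + b ≡ N
  L+b≡N = m+[n∸m]≡n (m+n≤o⇒m≤o L L+e≤N)

  e≤b : e ≤ b
  e≤b = m+n≤o⇒m≤o∸n e (subst (_≤ N) (+-comm L e) L+e≤N)

  private
    -- Replacing N by b inside L binomials `N C d` costs at most this second-order error; `large`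
    -- keeps it below one `N C d`.
    LLE≤ : L * (L * (N C e)) ≤ N C d
    LLE≤ = ≤-trans (≤-reflexive (sym (*-assoc L L (N C e)))) (*-C≤C-suc (L * L) large)

    upper : ∀ k → N C suc k ≤ b C suc k + L * (N C k)
    upper k = subst (λ z → z C suc k ≤ b C suc k + L * (z C k)) L+b≡N (C-suc-+-upper b L k)

    -- The difference between `N C d` and c is at most L C(N, e). Since 2 ≤ L, twice this is at most
    -- L² C(N, e), hence at most `N C d`.
    C[N,d]≤2c : N C d ≤ 2 * c
    C[N,d]≤2c = +-cancelʳ-≤ (N C d) (N C d) (2 * c) (begin
      N C d + N C d                   ≡⟨ double (N C d) ⟩
      2 * (N C d)                     ≤⟨ *-monoʳ-≤ 2 (upper e) ⟩
      2 * (c + L * (N C e))           ≡⟨ *-distribˡ-+ 2 c _ ⟩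
      2 * c + 2 * (L * (N C e))       ≤⟨ +-monoʳ-≤ (2 * c) (*-monoˡ-≤ (L * (N C e)) 2≤L) ⟩
      2 * c + L * (L * (N C e))       ≤⟨ +-monoʳ-≤ (2 * c) LLE≤ ⟩
      2 * c + N C d                   ∎)
      where
      open ≤-Reasoning
      double : ∀ x → x + x ≡ 2 * x
      double = solve-∀

  core-lower : b C suc d + L * c ≤ N C suc d
  core-lower = subst (λ z → b C suc d + L * c ≤ z C suc d) L+b≡N (C-suc-+-lower b L d)

  -- One `N C d` comes from passing from N to N + 1, another from the second-order error; each is at
  -- most 2 c, whence the 4.
  core-upper : suc N C suc d ≤ b C suc d + L * c + 4 * c
  core-upper = begin
    suc N C suc d                             ≡⟨ nCk+nC[k+1]≡[n+1]C[k+1] N d ⟨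
    N C d + N C suc d                         ≤⟨ +-monoʳ-≤ (N C d) (upper d) ⟩
    N C d + (b C suc d + L * (N C d))         ≤⟨ +-monoʳ-≤ (N C d) (+-monoʳ-≤ (b C suc d) (begin
      L * (N C d)                             ≤⟨ *-monoʳ-≤ L (upper e) ⟩
      L * (c + L * (N C e))                   ≡⟨ *-distribˡ-+ L c _ ⟩
      L * c + L * (L * (N C e))               ≤⟨ +-monoʳ-≤ (L * c) LLE≤ ⟩
      L * c + N C d                           ∎)) ⟩
    N C d + (b C suc d + (L * c + N C d))     ≡⟨ collect (N C d) (b C suc d) (L * c) ⟩
    b C suc d + L * c + 2 * (N C d)           ≤⟨ +-monoʳ-≤ (b C suc d + L * c) (*-monoʳ-≤ 2 C[N,d]≤2c) ⟩
    b C suc d + L * c + 2 * (2 * c)           ≡⟨ cong (b C suc d + L * c +_) (*-assoc 2 2 c) ⟨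
    b C suc d + L * c + 4 * c                 ∎
    where
    open ≤-Reasoning
    collect : ∀ x y z → x + (y + (z + x)) ≡ y + z + 2 * x
    collect = solve-∀

-- Choice of the parameters.

-- With L = M^(3d), `M ^ power e` is M · M · L²: the two extra factors M absorb the coefficient d
-- and the summand e in `large`.
power : ℕ → ℕ
power e = 2 + (3 * suc e + 3 * suc e)

-- The remainder is below (M + 1)^(power · d), and M + 1 ≤ M² accounts for the factor 2. The value
-- depends on e alone.
rounds : ℕ → ℕ
rounds e = 2 * power e * suc e

module BigStep (e M N : ℕ) (M-large : 3 + e ≤ M)
  (N-lower : M ^ power e ≤ N) (N-upper : N < suc M ^ power e) where

  private
    d = suc e
    L = M ^ (3 * d)
    b = N ∸ L
    c = b C d

    instance
      M≢0 : NonZero M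
      M≢0 = >-nonZero (≤-trans (s≤s z≤n) M-large)

    2≤M : 2 ≤ M
    2≤M = ≤-trans (s≤s (s≤s z≤n)) M-large

    d≤M : d ≤ M
    d≤M = ≤-trans (m≤n+m d 2) M-large

    e≤M : e ≤ M
    e≤M = ≤-trans (m≤n+m e 3) M-large

    2≤L : 2 ≤ L
    2≤L = ≤-trans 2≤M (≤-trans (≤-reflexive (sym (*-identityʳ M)))
      (^-monoʳ-≤ M {1} {3 * d} (s≤s z≤n)))

    instance
      L≢0 : NonZero L
      L≢0 = >-nonZero (≤-trans (s≤s z≤n) 2≤L)

    large : d * (L * L) + e ≤ N
    large = begin
      d * (L * L) + e                ≤⟨ +-mono-≤ (*-monoˡ-≤ (L * L) d≤M)
                                          (≤-trans e≤M (m≤m*n M (L * L) {{m*n≢0 L L}})) ⟩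
      M * (L * L) + M * (L * L)      ≡⟨ double M (L * L) ⟩
      2 * (M * (L * L))              ≤⟨ *-monoˡ-≤ (M * (L * L)) 2≤M ⟩
      M * (M * (L * L))              ≡⟨ cong (λ z → M * (M * z)) (^-distribˡ-+-* M (3 * d) (3 * d)) ⟨
      M ^ power e                    ≤⟨ N-lower ⟩
      N                              ∎
      where
      open ≤-Reasoning
      double : ∀ x y → x * y + x * y ≡ 2 * (x * y)
      double = solve-∀

    -- Here x ≤ M³, so x^e ≤ M^(3e) ≤ L; this explains the exponent 3 d of L.
    small : ∀ x → x < d * M + e → x C e ≤ L
    small x x< = begin
      x C e          ≤⟨ C≤^ x e ⟩
      x ^ e          ≤⟨ ^-monoˡ-≤ e x≤ ⟩
      (M ^ 3) ^ e    ≤⟨ ^-monoʳ-≤ (M ^ 3) {{m^n≢0 M 3}} (n≤1+n e) ⟩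
      (M ^ 3) ^ d    ≡⟨ ^-*-assoc M 3 d ⟩
      L              ∎
      where
      open ≤-Reasoning
      cube : ∀ M → M * (M * M) ≡ M * (M * (M * 1))
      cube = solve-∀
      double : ∀ x → x + x ≡ 2 * x
      double = solve-∀
      x≤ : x ≤ M ^ 3
      x≤ = begin
        x                  ≤⟨ <⇒≤ x< ⟩
        d * M + e          ≤⟨ +-mono-≤ (*-monoˡ-≤ M d≤M) (≤-trans e≤M (m≤m*n M M)) ⟩
        M * M + M * M      ≡⟨ double (M * M) ⟩
        2 * (M * M)        ≤⟨ *-monoˡ-≤ (M * M) 2≤M ⟩
        M * (M * M)        ≡⟨ cube M ⟩
        M ^ 3              ∎

    suc-M≤M^2 : suc M ≤ M ^ 2
    suc-M≤M^2 = begin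
      1 + M          ≤⟨ +-monoˡ-≤ M (≤-trans (s≤s z≤n) 2≤M) ⟩
      M + M          ≡⟨ double M ⟩
      2 * (M * 1)    ≤⟨ *-monoˡ-≤ (M * 1) 2≤M ⟩
      M ^ 2          ∎
      where
      open ≤-Reasoning
      double : ∀ x → x + x ≡ 2 * (x * 1)
      double = solve-∀

    c<M^rounds : c < M ^ rounds e
    c<M^rounds = begin-strict
      c                              ≤⟨ C≤^ b d ⟩
      b ^ d                          ≤⟨ ^-monoˡ-≤ d (m∸n≤m N L) ⟩
      N ^ d                          <⟨ ^-monoˡ-< d N-upper ⟩
      (suc M ^ power e) ^ d          ≤⟨ ^-monoˡ-≤ d (^-monoˡ-≤ (power e) suc-M≤M^2) ⟩
      ((M ^ 2) ^ power e) ^ d        ≡⟨ cong (_^ d) (^-*-assoc M 2 (power e)) ⟩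
      (M ^ (2 * power e)) ^ d        ≡⟨ ^-*-assoc M (2 * power e) d ⟩
      M ^ rounds e                   ∎
      where open ≤-Reasoning

    open Core 2≤L large
    open Greedy b e M L small

    c<C[1+b,d] : c < suc b C d
    c<C[1+b,d] = subst (c <_) (nCk+nC[k+1]≡[n+1]C[k+1] b e) (m<n+m c (k≤n⇒nCk>0 e≤b))

  representable : ∀ {h} → N C suc d ≤ h → h ≤ suc N C suc d →
    Representable e (N + (5 + rounds e)) h
  representable {h} lower upper
    with divideOut {b} {e} 4 {h ∸ (b C suc d + L * c)} (m≤n+o⇒m∸n≤o h (b C suc d + L * c) (≤-trans upper core-upper))
  ... | T , R , s , eq , R≤c
    with greedy (rounds e) (≤-<-trans R≤c c<C[1+b,d]) (inj₂ (≤-<-trans R≤c c<M^rounds))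
  -- The final remainder r decides how many of the L hubs meet the last vertex. The other L - r
  -- become terms with x = b, so the number of vertices does not depend on r.
  ...   | T′ , r , s′ , eq′ , r≤L = representation {r = r} e≤b (copies (L ∸ r) ≤-refl ++ˢ s ++ˢ s′)
    (≤-reflexive size≡) total≡
    where
    open ≡-Reasoning
    L≡ : L ∸ r + r ≡ L
    L≡ = m∸n+n≡m r≤L
    arrange : ∀ l t r b → suc (l + (4 + t) + (r + b)) ≡ l + r + b + (5 + t)
    arrange = solve-∀
    size≡ : suc (L ∸ r + (4 + rounds e) + (r + b)) ≡ N + (5 + rounds e)
    size≡ = begin
      suc (L ∸ r + (4 + rounds e) + (r + b))   ≡⟨ arrange (L ∸ r) (rounds e) r b ⟩
      L ∸ r + r + b + (5 + rounds e)           ≡⟨ cong (λ z → z + b + (5 + rounds e)) L≡ ⟩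
      L + b + (5 + rounds e)                   ≡⟨ cong (_+ (5 + rounds e)) L+b≡N ⟩
      N + (5 + rounds e)                       ∎
    collect : ∀ x l r c T T′ →
      x + (l + r) * c + (T + (T′ + r)) ≡ x + r * c + (l * c + (T + T′)) + r
    collect = solve-∀
    total≡ : h ≡ b C suc d + r * c + ((L ∸ r) * c + (T + T′)) + r
    total≡ = begin
      h                                          ≡⟨ m+[n∸m]≡n (≤-trans core-lower lower) ⟨
      b C suc d + L * c + (h ∸ (b C suc d + L * c))
        ≡⟨ cong (b C suc d + L * c +_) (trans eq (cong (T +_) eq′)) ⟩
      b C suc d + L * c + (T + (T′ + r))
        ≡⟨ cong (λ z → b C suc d + z * c + (T + (T′ + r))) L≡ ⟨
      b C suc d + (L ∸ r + r) * c + (T + (T′ + r))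
        ≡⟨ collect (b C suc d) (L ∸ r) r c T T′ ⟩
      b C suc d + r * c + ((L ∸ r) * c + (T + T′)) + r  ∎

-- The threshold and the induction on n.

threshold : ℕ → ℕ
threshold e = (3 + e) ^ power e

-- Shifting the argument by 3 + e builds the lower bound on M into the search; the threshold is the
-- value at 0.
root : ∀ e N → threshold e ≤ N →
  ∃ λ M → 3 + e ≤ M × M ^ power e ≤ N × N < suc M ^ power e
root e N start with crossing (λ m → (m + (3 + e)) ^ power e) start N N<
  where
  N< : N < (N + (3 + e)) ^ power e
  N< = begin-strict
    N                          <⟨ m<m+n N (s≤s z≤n) ⟩
    N + (3 + e)                ≡⟨ *-identityʳ _ ⟨
    (N + (3 + e)) ^ 1
      ≤⟨ ^-monoʳ-≤ (N + (3 + e)) {{>-nonZero (≤-trans (s≤s z≤n) (m≤n+m (3 + e) N))}}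
           {1} {power e} (s≤s z≤n) ⟩
    (N + (3 + e)) ^ power e    ∎
    where open ≤-Reasoning
... | m , _ , low , high = m + (3 + e) , m≤n+m _ m , low , high

fewCliques : ℕ → ℕ
fewCliques e = threshold e C suc (suc e)

-- The first summand pays for n up to the threshold, the second for all larger n.
slack : ℕ → ℕ
slack e = suc (fewCliques e + suc e) + (5 + rounds e)

representable-slack : ∀ e n {h} → h ≤ n C suc (suc e) → Representable e (n + slack e) h
representable-slack e n {h} h≤ with n ≤? threshold e
... | yes n≤ = Representable-mono
  (≤-trans (s≤s (+-monoˡ-≤ (suc e) (≤-trans h≤ (C-monoˡ (suc (suc e)) n≤))))
    (≤-trans (m≤m+n _ (5 + rounds e)) (m≤n+m (slack e) n)))
  (representable-few e h)
representable-slack e zero    h≤ | no 0≰ = contradiction z≤n 0≰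
representable-slack e (suc N) {h} h≤ | no n≰ with h ≤? N C suc (suc e)
... | yes h≤′ = Representable-mono (n≤1+n (N + slack e)) (representable-slack e N h≤′)
-- Now h lies between the counts for N and `suc N`, and N itself still reaches the threshold.
... | no  h≰ with root e N (s≤s⁻¹ (≰⇒> n≰))
...   | M , M-large , low , high = Representable-mono
  (≤-trans (+-monoʳ-≤ N (m≤n+m (5 + rounds e) (suc (fewCliques e + suc e)))) (n≤1+n (N + slack e)))
  (BigStep.representable e M N M-large low high (<⇒≤ (≰⇒> h≰)) h≤)

theorem4 : Σ (ℕ → ℕ) λ γ →
    (k n h : ℕ) → 2 ≤ k → 1 ≤ n → h ≤ n C k →
    Σ (Graph (n + γ (k ∸ 1) ∸ 1)) λ G → subK k G ≡ h
-- γ is evaluated at d = k - 1 while `slack` takes e = k - 2, hence `pred`; the `suc` cancels the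
-- final `∸ 1`.
theorem4 = (λ d → suc (slack (pred d))) , λ where
  (suc (suc e)) n h (s≤s (s≤s z≤n)) 1≤n h≤ → representable⇒graph
    (subst (λ N → Representable e N h) (sym (cong (_∸ 1) (+-suc n (slack e))))
      (representable-slack e n h≤))
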